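{- Let $P\subset\mathbb{R}^d$ be a simple polytope, $c$ a generic objective function, and $\eta$ a normalization. For any two weights $w,w'\in\mathbb{R}^d$ we have $$\mathcal{A}^\eta_{P,c}(w)\preceq\mathcal{A}^\eta_{P,c}(w')\quad\Longleftrightarrow\quad(\Pi^\eta_{P,c})^w\subseteq(\Pi^\eta_{P,c})^{w'}.$$ Thus, the poset of coherent $c$-multi-arborescences, ordered by $\preceq$, is isomorphic to the poset of nonempty faces of the pivot rule polytope $\Pi^\eta_{P,c}$, ordered by inclusion.
   Context: A $k$-dimensional polytope is simple if every vertex is incident to exactly $k$ edges. $c\in\mathbb{R}^d$ is generic for $P$ if $c^tu\neq c^tv$ for all edges $uv$; $v_{opt}$ is then the unique maximizing vertex, and $\mathrm{Nb}_{P,c}(v)$ is the set of vertices $u$ adjacent to $v$ with $c^tu>c^tv$. A normalization is a function $\eta:\mathbb{R}^d\to\mathbb{R}$ with $\eta(u-v)\neq0$ whenever $u\in\mathrm{Nb}_{P,c}(v)$. A $c$-multi-arborescence is a map $\mathcal{A}:V(P)\to2^{V(P)}\setminus\{\emptyset\}$ with $\mathcal{A}(v_{opt})=\{v_{opt}\}$ and $\mathcal{A}(v)\subseteq\mathrm{Nb}_{P,c}(v)$ for $v\neq v_{opt}$; it is a $c$-arborescence if $|\mathcal{A}(v)|=1$ for all $v$ (then $\mathcal{A}(v)$ is identified with its element). Write $\mathcal{A}\preceq\mathcal{A}'$ if $\mathcal{A}(v)\subseteq\mathcal{A}'(v)$ for all $v\in V(P)$. For an arbitrary weight $w\in\mathbb{R}^d$,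 $\mathcal{A}^\eta_{P,c}(w)$ is the $c$-multi-arborescence such that, for $v\neq v_{opt}$, $\mathcal{A}^\eta_{P,c}(w)(v)$ is the set of all maximizers of $\frac{w^t(u-v)}{\eta(u-v)}$ over $u\in\mathrm{Nb}_{P,c}(v)$. A $c$-multi-arborescence is coherent if it is of this form for some $w$. The pivot rule polytope is $$\Pi^\eta_{P,c}=\operatorname{conv}\left\{\sum_{v\neq v_{opt}}\frac{\mathcal{A}(v)-v}{\eta(\mathcal{A}(v)-v)} : \mathcal{A}\text{ a }c\text{ -arborescence}\right\}.$$ For a polytope $Q$ and $w\in\mathbb{R}^d$, $Q^w$ is the face of $Q$ on which $x\mapsto w^tx$ is maximal. -}

module Defs where

open import Level using (0ℓ; _⊔_) renaming (suc to lsuc)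
open import Algebra.Bundles using (CommutativeRing; RawMonoid)
open import Algebra.Structures using (IsCommutativeRing)
import Algebra.Definitions.RawMonoid as RawMonoidDefs
open import Data.Bool.Base using (if_then_else_)
open import Data.Fin.Base using (Fin)
import Data.Fin.Base as Fin
open import Data.Fin.Properties using (_≟_)
open import Data.Fin.Subset using (Subset; ∣_∣) renaming (_∈_ to _∈ₛ_)
open import Data.List.Base using (allFin)
import Data.List.Extrema as Extrema
open import Data.Nat.Base using (ℕ; suc) renaming (_≤_ to _≤ℕ_)
open import Data.Product.Base using (Σ; ∃-syntax; _×_; _,_; proj₁)
open import Data.Sum.Base using (_⊎_)
open import Data.Vec.Base using (Vec; lookup; map; zipWith; replicate)
open import Function.Bundles using (_⇔_)
open import Function.Definitions using (Injective)
open import Relation.Binary.Bundles using (TotalOrder; Poset)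
import Relation.Binary.Construct.On as On
open import Relation.Binary.Morphism.Structures using (IsOrderIsomorphism)
open import Relation.Binary.Structures using (IsTotalOrder)
open import Relation.Binary.PropositionalEquality using (_≡_; _≢_)
open import Relation.Nullary.Decidable.Core using (does)
open import Relation.Unary using (Pred; _∈_; _⊆_; _≐_; ｛_｝; Satisfiable)
open import Relation.Unary.Properties using (≐-refl; ≐-sym; ≐-trans)
open import Relation.Unary.Relation.Binary.Subset using (⊆-poset)

-- The real numbers, axiomatised as a Dedekind-complete totally ordered field;
-- classically this determines ℝ up to unique isomorphism.  The inverse is a
-- total function whose value at 0# is unconstrained.
record RealNumbers : Set (lsuc 0ℓ) where
  infix  4 _≤_ _<_
  infixl 6 _+_
  infixl 7 _*_
  infix  8 -_
  infix  9 _⁻¹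
  field
    ℝ                 : Set
    _+_ _*_           : ℝ → ℝ → ℝ
    -_ _⁻¹            : ℝ → ℝ
    0# 1#             : ℝ
    _≤_               : ℝ → ℝ → Set
    isCommutativeRing : IsCommutativeRing _≡_ _+_ _*_ -_ 0# 1#
    0≢1               : 0# ≢ 1#
    *-inverseʳ        : ∀ x → x ≢ 0# → x * x ⁻¹ ≡ 1#
    isTotalOrder      : IsTotalOrder _≡_ _≤_
    +-monoˡ-≤         : ∀ z {x y} → x ≤ y → x + z ≤ y + z
    *-nonneg          : ∀ {x y} → 0# ≤ x → 0# ≤ y → 0# ≤ x * y

  IsUpperBound : Pred ℝ 0ℓ → Pred ℝ 0ℓ
  IsUpperBound S b = ∀ {x} → x ∈ S → x ≤ b

  field
    complete : (S : Pred ℝ 0ℓ) → Satisfiable S → Satisfiable (IsUpperBound S) →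
               ∃[ s ] IsUpperBound S s × (∀ b → IsUpperBound S b → s ≤ b)

  _<_ : ℝ → ℝ → Set
  x < y = x ≤ y × x ≢ y

  commutativeRing : CommutativeRing 0ℓ 0ℓ
  commutativeRing = record { isCommutativeRing = isCommutativeRing }

  totalOrder : TotalOrder 0ℓ 0ℓ 0ℓ
  totalOrder = record { isTotalOrder = isTotalOrder }

-- Set-valued maps V → 2^V, compared pointwise.
MultiMap : Set → Set (lsuc 0ℓ)
MultiMap V = V → Pred V 0ℓ

infix 4 _⪯_ _≗ₘ_

_⪯_ _≗ₘ_ : {V : Set} → MultiMap V → MultiMap V → Set
A ⪯ B  = ∀ v → A v ⊆ B v
A ≗ₘ B = ∀ v → A v ≐ B v

multiMapPoset : Set → Poset (lsuc 0ℓ) 0ℓ 0ℓ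
multiMapPoset V = record
  { Carrier = MultiMap V
  ; _≈_     = _≗ₘ_
  ; _≤_     = _⪯_
  ; isPartialOrder = record
    { isPreorder = record
      { isEquivalence = record
        { refl  = λ _ → ≐-refl
        ; sym   = λ p v → ≐-sym (p v)
        ; trans = λ p q v → ≐-trans (p v) (q v)
        }
      ; reflexive = λ p v → proj₁ (p v)
      ; trans     = λ p q v x → q v (p v x)
      }
    ; antisym = λ p q v → p v , q v
    }
  }

infix 4 _≅_

_≅_ : ∀ {a b ℓ₁ ℓ₂ ℓ₃ ℓ₄} → Poset a ℓ₁ ℓ₃ → Poset b ℓ₂ ℓ₄ → Set (a ⊔ b ⊔ ℓ₁ ⊔ ℓ₂ ⊔ ℓ₃ ⊔ ℓ₄)
X ≅ Y = ∃[ f ] IsOrderIsomorphism X._≈_ Y._≈_ X._≤_ Y._≤_ f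
  where
  module X = Poset X
  module Y = Poset Y

module Geometry (R : RealNumbers) where

  open RealNumbers R

  infixl 6 _+ᵥ_ _-ᵥ_
  infixr 7 _•_
  infix  7 _·_

  _+ᵥ_ _-ᵥ_ : ∀ {d} → Vec ℝ d → Vec ℝ d → Vec ℝ d
  _+ᵥ_ = zipWith _+_
  _-ᵥ_ = zipWith (λ a b → a + - b)

  _•_ : ∀ {d} → ℝ → Vec ℝ d → Vec ℝ d
  t • x = map (t *_) x

  0ᵥ : ∀ {d} → Vec ℝ d
  0ᵥ = replicate _ 0#

  +ᵥ-rawMonoid : ℕ → RawMonoid 0ℓ 0ℓ
  +ᵥ-rawMonoid d = record { Carrier = Vec ℝ d ; _≈_ = _≡_ ; _∙_ = _+ᵥ_ ; ε = 0ᵥ }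

  ∑ : ∀ {n} → (Fin n → ℝ) → ℝ
  ∑ = RawMonoidDefs.sum (CommutativeRing.+-rawMonoid commutativeRing)

  ∑ᵥ : ∀ {d n} → (Fin n → Vec ℝ d) → Vec ℝ d
  ∑ᵥ {d} = RawMonoidDefs.sum (+ᵥ-rawMonoid d)

  _·_ : ∀ {d} → Vec ℝ d → Vec ℝ d → ℝ
  w · x = ∑ (λ i → lookup w i * lookup x i)

  conv : ∀ {d} → Pred (Vec ℝ d) 0ℓ → Pred (Vec ℝ d) 0ℓ
  conv {d} S x =
    ∃[ m ] Σ (Fin m → ℝ) λ t → Σ (Fin m → Vec ℝ d) λ p →
      (∀ i → 0# ≤ t i) × (∑ t ≡ 1#) × (∀ i → p i ∈ S) × (x ≡ ∑ᵥ (λ i → t i • p i))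

  -- face Q w is the set written Q^w.
  face : ∀ {d} → Pred (Vec ℝ d) 0ℓ → Vec ℝ d → Pred (Vec ℝ d) 0ℓ
  face Q w x = x ∈ Q × (∀ y → y ∈ Q → w · y ≤ w · x)

  AffinelyIndependent : ∀ {d m} → (Fin m → Vec ℝ d) → Set
  AffinelyIndependent p =
    ∀ t → ∑ t ≡ 0# → ∑ᵥ (λ i → t i • p i) ≡ 0ᵥ → ∀ i → t i ≡ 0#

  HasDimension : ∀ {d} → ℕ → Pred (Vec ℝ d) 0ℓ → Set
  HasDimension {d} k X =
    (Σ (Fin (suc k) → Vec ℝ d) λ p → (∀ i → p i ∈ X) × AffinelyIndependent p) ×
    (∀ {m} (p : Fin m → Vec ℝ d) → (∀ i → p i ∈ X) → AffinelyIndependent p → m ≤ℕ suc k)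

  -- A nonempty polytope, presented as the convex hull of its vertices: the
  -- vertices (zero-dimensional faces) are listed without repetition, and V(P)
  -- is the index type Fin (suc #vertices-1).
  record Polytope (d : ℕ) : Set where
    field
      #vertices-1 : ℕ

    V : Set
    V = Fin (suc #vertices-1)

    field
      point : V → Vec ℝ d

    points : Pred (Vec ℝ d) 0ℓ
    points x = ∃[ v ] point v ≡ x

    body : Pred (Vec ℝ d) 0ℓ
    body = conv points

    field
      point-injective : Injective _≡_ _≡_ point
      point-isVertex  : ∀ v → ∃[ w ] face body w ≐ ｛ point v ｝

    segment : V → V → Pred (Vec ℝ d) 0ℓ
    segment u v = conv (λ x → x ≡ point u ⊎ x ≡ point v)

    -- The edges are the faces that are segments between two distinct vertices.
    IsEdge : V → V → Set
    IsEdge u v = u ≢ v × (∃[ w ] face body w ≐ segment u v)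

  IsSimple : ∀ {d} → Polytope d → Set
  IsSimple P =
    ∃[ k ] HasDimension k body ×
      (∀ v → Σ (Subset (suc #vertices-1)) λ N → ∣ N ∣ ≡ k × (∀ u → u ∈ₛ N ⇔ IsEdge v u))
    where open Polytope P

  IsGeneric : ∀ {d} → Polytope d → Vec ℝ d → Set
  IsGeneric P c = ∀ u v → IsEdge u v → c · point u ≢ c · point v
    where open Polytope P

  module _ {d : ℕ} (P : Polytope d) (c : Vec ℝ d) (η : Vec ℝ d → ℝ) where

    open Polytope P

    -- A vertex maximizing c; it is the only one when c is generic for P.
    v-opt : V
    v-opt = Extrema.argmax totalOrder (λ v → c · point v) Fin.zero (allFin _)

    Nb : V → Pred V 0ℓ
    Nb v u = IsEdge v u × c · point v < c · point u

    IsNormalization : Set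
    IsNormalization = ∀ v u → u ∈ Nb v → η (point u -ᵥ point v) ≢ 0#

    IsMultiArborescence : MultiMap V → Set
    IsMultiArborescence A =
      (∀ v → Satisfiable (A v)) ×
      (A v-opt ≐ ｛ v-opt ｝) ×
      (∀ v → v ≢ v-opt → A v ⊆ Nb v)

    -- Singleton-valued multi-arborescences, identified with functions.
    IsArborescence : (V → V) → Set
    IsArborescence a = IsMultiArborescence (λ v → ｛ a v ｝)

    slope : Vec ℝ d → V → V → ℝ
    slope w v u = (w · (point u -ᵥ point v)) * (η (point u -ᵥ point v)) ⁻¹

    arborescenceOf : Vec ℝ d → MultiMap V
    arborescenceOf w v u =
      (v ≡ v-opt × u ≡ v-opt) ⊎
      (v ≢ v-opt × u ∈ Nb v × (∀ u′ → u′ ∈ Nb v → slope w v u′ ≤ slope w v u))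

    record CoherentMultiArborescence : Set (lsuc 0ℓ) where
      field
        multiMap            : MultiMap V
        isMultiArborescence : IsMultiArborescence multiMap
        isCoherent          : ∃[ w ] multiMap ≗ₘ arborescenceOf w

    coherentPoset : Poset (lsuc 0ℓ) 0ℓ 0ℓ
    coherentPoset = On.poset (multiMapPoset V) CoherentMultiArborescence.multiMap

    pivotPoint : (V → V) → Vec ℝ d
    pivotPoint a = ∑ᵥ λ v →
      if does (v ≟ v-opt)
      then 0ᵥ
      else (η (point (a v) -ᵥ point v)) ⁻¹ • (point (a v) -ᵥ point v)

    Π : Pred (Vec ℝ d) 0ℓ
    Π = conv (λ x → Σ (V → V) λ a → IsArborescence a × x ≡ pivotPoint a)

    record NonemptyFace : Set (lsuc 0ℓ) where
      field
        set      : Pred (Vec ℝ d) 0ℓ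
        nonempty : Satisfiable set
        isFace   : ∃[ w ] set ≐ face Π w

    facePoset : Poset (lsuc 0ℓ) 0ℓ 0ℓ
    facePoset = On.poset (⊆-poset (Vec ℝ d) 0ℓ) NonemptyFace.set

{-# OPTIONS --safe #-}
module Submission where

-- Since w · pivotPoint a is a sum over v of the slopes w assigns to the edges v → a v, an
-- arborescence maximizes w exactly when each a v is among the maximizers collected in 𝒜(w)(v).
-- Hence Π^w is the convex hull of the pivot points of the selections from 𝒜(w), which gives one
-- direction; conversely every u ∈ 𝒜(w)(v) is taken by some selection, whose pivot point lies in Π^w.
--
-- Selections exist because every v ≠ v-opt has a c-improving edge. To see this, cut the rays from
-- v by a hyperplane near v. Among the points dir x of this vertex figure, one maximizing
-- |dir x|² + N (c · dir x) is a vertex of the figure, hence spans an edge of P, and for N large it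
-- does not decrease c.

open import Level using (0ℓ)
open import Axiom.ExcludedMiddle using (ExcludedMiddle)
open import Data.Nat.Base using (ℕ)
open import Data.Product.Base using (_×_)
open import Data.Vec.Base using (Vec)
open import Function.Bundles using (_⇔_)
open import Relation.Unary using (_⊆_)
open import Defs
open import Algebra.Bundles using (CommutativeRing)
import Algebra.Properties.Ring as RingProperties
import Algebra.Properties.Semiring.Sum as Sum
import Algebra.Solver.Ring.NaturalCoefficients.Default as RingSolver
open import Data.Bool.Base using (if_then_else_; true; false)
open import Data.Fin.Base using (Fin; zero; suc)
open import Data.Fin.Properties using (_≟_)
open import Data.List.Base using (allFin; filter; tabulate)
import Data.List.Extrema as Extrema
open import Data.List.Membership.Propositional.Properties using (∈-allFin; ∈-filter⁺)
open import Data.List.Relation.Unary.All using (lookup)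
open import Data.List.Relation.Unary.All.Properties using (all-filter; tabulate⁻)
import Data.Nat.Base as ℕ
open import Data.Product.Base using (∃; ∃-syntax; _,_; proj₁; proj₂)
open import Data.Sum.Base using (_⊎_; inj₁; inj₂)
import Data.Vec.Base as Vec
import Data.Vec.Properties as Vecₚ
open import Data.Vec.Relation.Binary.Pointwise.Extensional using (ext; Pointwise-≡⇒≡)
open import Function.Base using (_∘_)
open import Function.Bundles using (mk⇔)
open import Relation.Binary.Bundles using (TotalOrder)
import Relation.Binary.Reasoning.PartialOrder as PartialOrderReasoning
open import Relation.Binary.PropositionalEquality
  using (_≡_; _≢_; refl; sym; trans; cong; cong₂; subst; subst₂; ≢-sym; ≡-≟-identity)
open import Relation.Nullary using (Dec; yes; no; does; ¬_; contradiction)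
open import Relation.Unary using (Pred; _∈_; _≐_; Satisfiable)
open import Relation.Unary.Properties using (≐-refl)

-- Inequalities in an ordered field, and maxima over finite sets.

module OrderedField (R : RealNumbers) where

  open RealNumbers R
  open CommutativeRing commutativeRing public using
    ( +-comm; +-assoc; +-identityˡ; +-identityʳ; -‿inverseˡ; -‿inverseʳ
    ; *-comm; *-assoc; *-identityˡ; *-identityʳ; distribˡ; distribʳ; zeroˡ; zeroʳ
    ; ring; semiring; commutativeSemiring )
  open RingProperties ring public using (-‿distribʳ-*; -‿distribˡ-*; -‿involutive; +-cancelʳ)
  open RingSolver commutativeSemiring public using (solve; _:=_; _:+_; _:*_)
  open TotalOrder totalOrder public using (poset; total; antisym)
    renaming (refl to ≤-refl; reflexive to ≤-reflexive; trans to ≤-trans)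
  open PartialOrderReasoning poset public

  +-monoʳ-≤ : ∀ z {x y} → x ≤ y → z + x ≤ z + y
  +-monoʳ-≤ z {x} {y} x≤y = subst₂ _≤_ (+-comm x z) (+-comm y z) (+-monoˡ-≤ z x≤y)

  +-mono-≤ : ∀ {x y z t} → x ≤ y → z ≤ t → x + z ≤ y + t
  +-mono-≤ {y = y} {z = z} x≤y z≤t = ≤-trans (+-monoˡ-≤ z x≤y) (+-monoʳ-≤ y z≤t)

  [x-y]+y≡x : ∀ x y → (x + - y) + y ≡ x
  [x-y]+y≡x x y = trans (+-assoc x (- y) y) (trans (cong (x +_) (-‿inverseˡ y)) (+-identityʳ x))

  [x+y]-y≡x : ∀ x y → (x + y) + - y ≡ x
  [x+y]-y≡x x y = trans (+-assoc x y (- y)) (trans (cong (x +_) (-‿inverseʳ y)) (+-identityʳ x))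

  +-cancelʳ-≤ : ∀ z {x y} → x + z ≤ y + z → x ≤ y
  +-cancelʳ-≤ z {x} {y} p = subst₂ _≤_ ([x+y]-y≡x x z) ([x+y]-y≡x y z) (+-monoˡ-≤ (- z) p)

  x≤y⇒0≤y-x : ∀ {x y} → x ≤ y → 0# ≤ y + - x
  x≤y⇒0≤y-x {x} {y} x≤y = subst (_≤ y + - x) (-‿inverseʳ x) (+-monoˡ-≤ (- x) x≤y)

  x<y⇒0<y-x : ∀ {x y} → x < y → 0# < y + - x
  x<y⇒0<y-x {x} {y} (x≤y , x≢y) = x≤y⇒0≤y-x x≤y ,
    λ 0≡y-x → x≢y (trans (sym (+-identityˡ x)) (trans (cong (_+ x) 0≡y-x) ([x-y]+y≡x y x)))

  0≤y⇒x≤y+x : ∀ {y} x → 0# ≤ y → x ≤ y + x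
  0≤y⇒x≤y+x {y} x 0≤y = subst (_≤ y + x) (+-identityˡ x) (+-monoˡ-≤ x 0≤y)

  ≤⇒≯ : ∀ {x y} → x ≤ y → ¬ (y < x)
  ≤⇒≯ x≤y (y≤x , y≢x) = y≢x (antisym y≤x x≤y)

  *-monoˡ-≤ : ∀ {z x y} → 0# ≤ z → x ≤ y → z * x ≤ z * y
  *-monoˡ-≤ {z} {x} {y} 0≤z x≤y = begin
    z * x                   ≤⟨ 0≤y⇒x≤y+x (z * x) (*-nonneg 0≤z (x≤y⇒0≤y-x x≤y)) ⟩
    z * (y + - x) + z * x   ≡⟨ distribˡ z (y + - x) x ⟨
    z * ((y + - x) + x)     ≡⟨ cong (z *_) ([x-y]+y≡x y x) ⟩
    z * y                   ∎

  *-cancelˡ-≡ : ∀ {z x y} → z ≢ 0# → z * x ≡ z * y → x ≡ y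
  *-cancelˡ-≡ {z} {x} {y} z≢0 eq = trans (sym (undo x)) (trans (cong (z ⁻¹ *_) eq) (undo y))
    where
    undo : ∀ t → z ⁻¹ * (z * t) ≡ t
    undo t = trans (sym (*-assoc (z ⁻¹) z t))
      (trans (cong (_* t) (trans (*-comm (z ⁻¹) z) (*-inverseʳ z z≢0))) (*-identityˡ t))

  *-cancelˡ-≤ : ∀ {z x y} → 0# < z → z * x ≤ z * y → x ≤ y
  *-cancelˡ-≤ {z} {x} {y} (0≤z , 0≢z) zx≤zy with total x y
  ... | inj₁ x≤y = x≤y
  ... | inj₂ y≤x = ≤-reflexive (*-cancelˡ-≡ (≢-sym 0≢z) (antisym zx≤zy (*-monoˡ-≤ 0≤z y≤x)))

  *-monoʳ-≤ : ∀ {z x y} → 0# ≤ z → x ≤ y → x * z ≤ y * z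
  *-monoʳ-≤ {z} {x} {y} 0≤z x≤y = subst₂ _≤_ (*-comm z x) (*-comm z y) (*-monoˡ-≤ 0≤z x≤y)

  x≤0⇒0≤-x : ∀ {x} → x ≤ 0# → 0# ≤ - x
  x≤0⇒0≤-x {x} x≤0 = subst (0# ≤_) (+-identityˡ (- x)) (x≤y⇒0≤y-x x≤0)

  x*x-nonneg : ∀ x → 0# ≤ x * x
  x*x-nonneg x with total 0# x
  ... | inj₁ 0≤x = *-nonneg 0≤x 0≤x
  ... | inj₂ x≤0 = subst (0# ≤_) -x*-x≡x*x (*-nonneg (x≤0⇒0≤-x x≤0) (x≤0⇒0≤-x x≤0))
    where
    -x*-x≡x*x : - x * - x ≡ x * x
    -x*-x≡x*x = trans (sym (-‿distribˡ-* x (- x)))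
      (trans (cong -_ (sym (-‿distribʳ-* x x))) (-‿involutive (x * x)))

  x*x≡0⇒x≡0 : ExcludedMiddle 0ℓ → ∀ {x} → x * x ≡ 0# → x ≡ 0#
  x*x≡0⇒x≡0 em {x} eq with em {x ≡ 0#}
  ... | yes x≡0 = x≡0
  ... | no  x≢0 = *-cancelˡ-≡ x≢0 (trans eq (sym (zeroʳ x)))

  0<1 : 0# < 1#
  0<1 = subst (0# ≤_) (*-identityˡ 1#) (x*x-nonneg 1#) , 0≢1

  ⁻¹-pos : ∀ {x} → 0# < x → 0# < x ⁻¹
  ⁻¹-pos {x} 0<x@(0≤x , 0≢x) = *-cancelˡ-≤ 0<x x*0≤x*x⁻¹ , λ 0≡x⁻¹ → 0≢1 (begin-equality
    0#         ≡⟨ zeroʳ x ⟨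
    x * 0#     ≡⟨ cong (x *_) 0≡x⁻¹ ⟩
    x * x ⁻¹   ≡⟨ *-inverseʳ x (≢-sym 0≢x) ⟩
    1#         ∎)
    where
    x*0≤x*x⁻¹ : x * 0# ≤ x * x ⁻¹
    x*0≤x*x⁻¹ = subst₂ _≤_ (sym (zeroʳ x)) (sym (*-inverseʳ x (≢-sym 0≢x))) (proj₁ 0<1)

  -- Substituting x = e + y makes this a semiring identity.
  [x-y]²+2xy≡x²+y² : ∀ x y → (x + - y) * (x + - y) + (x * y + x * y) ≡ x * x + y * y
  [x-y]²+2xy≡x²+y² x y =
    subst (λ t → e * e + (t * y + t * y) ≡ t * t + y * y) ([x-y]+y≡x x y)
      (solve 2 (λ e y → e :* e :+ ((e :+ y) :* y :+ (e :+ y) :* y) := (e :+ y) :* (e :+ y) :+ y :* y)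
        refl e y)
    where e = x + - y

  2xy≤x²+y² : ∀ x y → x * y + x * y ≤ x * x + y * y
  2xy≤x²+y² x y = subst (x * y + x * y ≤_) ([x-y]²+2xy≡x²+y² x y) (0≤y⇒x≤y+x _ (x*x-nonneg _))

  2xy≡x²+y²⇒x≡y : ExcludedMiddle 0ℓ → ∀ {x y} → x * y + x * y ≡ x * x + y * y → x ≡ y
  2xy≡x²+y²⇒x≡y em {x} {y} eq = begin-equality
    x               ≡⟨ [x-y]+y≡x x y ⟨
    (x + - y) + y   ≡⟨ cong (_+ y) x-y≡0 ⟩
    0# + y          ≡⟨ +-identityˡ y ⟩
    y               ∎
    where
    x-y≡0 : x + - y ≡ 0#
    x-y≡0 = x*x≡0⇒x≡0 em (+-cancelʳ (x * y + x * y) _ _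
      (trans ([x-y]²+2xy≡x²+y² x y) (trans (sym eq) (sym (+-identityˡ _)))))

  xy+zx≡x[y+z] : ∀ x y z → x * y + z * x ≡ x * (y + z)
  xy+zx≡x[y+z] = solve 3 (λ x y z → x :* y :+ z :* x := x :* (y :+ z)) refl

  x+[y+z]≡z+x+y : ∀ x y z → x + (y + z) ≡ z + x + y
  x+[y+z]≡z+x+y = solve 3 (λ x y z → x :+ (y :+ z) := z :+ x :+ y) refl

  -- Supplies the large `N` of the vertex-figure argument: with `a` the squared lengths of the
  -- `dir x` and `b` the values `- (c · dir x)`, any decrease of `c` outweighs the length.
  dominating-multiple : ∀ {n} (a b : Fin n → ℝ) →
                        ∃[ N ] 0# ≤ N × (∀ i → 0# < b i → a i < N * b i)
  dominating-multiple a b = N , Extrema.⊥≤max totalOrder 0# (tabulate ratio) , dominates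
    where
    ratio : _ → ℝ
    -- The summand `1#` makes the domination strict. Where `b i` is not positive the ratio has no
    -- meaning, but it can only enlarge `N`.
    ratio i = a i * b i ⁻¹ + 1#
    N = Extrema.max totalOrder 0# (tabulate ratio)
    ratio≤N : ∀ i → ratio i ≤ N
    ratio≤N = tabulate⁻ (Extrema.xs≤max totalOrder 0# (tabulate ratio))
    dominates : ∀ i → 0# < b i → a i < N * b i
    dominates i 0<bᵢ@(0≤bᵢ , 0≢bᵢ) = begin-strict
      a i                                     ≡⟨ +-identityˡ (a i) ⟨
      0# + a i                                <⟨ +-monoˡ-≤ (a i) 0≤bᵢ , 0≢bᵢ ∘ +-cancelʳ (a i) _ _ ⟩
      b i + a i                               ≡⟨ cong (b i +_) a*bb⁻¹≡a ⟨
      b i + a i * (b i * b i ⁻¹)              ≡⟨ rearrange (a i) (b i) (b i ⁻¹) ⟩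
      a i * b i ⁻¹ * b i + b i                ≡⟨ cong (a i * b i ⁻¹ * b i +_) (*-identityˡ (b i)) ⟨
      a i * b i ⁻¹ * b i + 1# * b i           ≡⟨ distribʳ (b i) (a i * b i ⁻¹) 1# ⟨
      ratio i * b i                           ≤⟨ *-monoʳ-≤ 0≤bᵢ (ratio≤N i) ⟩
      N * b i                                 ∎
      where
      a*bb⁻¹≡a : a i * (b i * b i ⁻¹) ≡ a i
      a*bb⁻¹≡a = trans (cong (a i *_) (*-inverseʳ (b i) (≢-sym 0≢bᵢ))) (*-identityʳ (a i))
      rearrange : ∀ a b b⁻¹ → b + a * (b * b⁻¹) ≡ a * b⁻¹ * b + b
      rearrange = solve 3 (λ a b b⁻¹ → b :+ a :* (b :* b⁻¹) := a :* b⁻¹ :* b :+ b) refl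

  maximizer : ExcludedMiddle 0ℓ → ∀ {n} (Q : Pred (Fin n) 0ℓ) → Satisfiable Q → (f : Fin n → ℝ) →
              ∃[ u ] u ∈ Q × (∀ x → x ∈ Q → f x ≤ f u)
  maximizer em Q (x₀ , Qx₀) f =
      -- Excluded middle lets `Q` be filtered out of the finite list; the default `x₀` lies in `Q`,
      -- so the result does too.
      Extrema.argmax totalOrder f x₀ xs
    , Extrema.argmax-all totalOrder f Qx₀ (all-filter Q? (allFin _))
    , λ x Qx → lookup (Extrema.f[xs]≤f[argmax] totalOrder {f = f} x₀ xs) (∈-filter⁺ Q? (∈-allFin x) Qx)
    where
    Q? = λ x → em {Q x}
    xs = filter Q? (allFin _)

-- Finite sums and dot products.

module LinearAlgebra (R : RealNumbers) where

  open RealNumbers R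
  open Geometry R
  open OrderedField R
  open Sum semiring using (sum-cong-≗; ∑-distrib-+; *-distribˡ-sum; *-distribʳ-sum; sum-replicate-zero)

  ∑-mono-≤ : ∀ {n} {f g : Fin n → ℝ} → (∀ i → f i ≤ g i) → ∑ f ≤ ∑ g
  ∑-mono-≤ {ℕ.zero}  f≤g = ≤-refl
  ∑-mono-≤ {ℕ.suc n} f≤g = +-mono-≤ (f≤g zero) (∑-mono-≤ (f≤g ∘ suc))

  -- A strict inequality in one term would make the totals differ strictly. This is how optimality
  -- of a sum becomes optimality of each summand.
  ∑-tight : ∀ {n} {f g : Fin n → ℝ} → (∀ i → f i ≤ g i) → ∑ g ≤ ∑ f → ∀ i → f i ≡ g i
  ∑-tight {ℕ.suc n} {f} {g} f≤g ∑g≤∑f zero = antisym (f≤g zero) (+-cancelʳ-≤ (∑ (g ∘ suc))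
    (≤-trans ∑g≤∑f (+-monoʳ-≤ (f zero) (∑-mono-≤ (f≤g ∘ suc)))))
  ∑-tight {ℕ.suc n} {f} {g} f≤g ∑g≤∑f (suc i) = ∑-tight (f≤g ∘ suc) tail i
    where
    tail : ∑ (g ∘ suc) ≤ ∑ (f ∘ suc)
    tail = +-cancelʳ-≤ (g zero) (begin
      ∑ (g ∘ suc) + g zero   ≡⟨ +-comm _ _ ⟩
      g zero + ∑ (g ∘ suc)   ≤⟨ ∑g≤∑f ⟩
      f zero + ∑ (f ∘ suc)   ≤⟨ +-monoˡ-≤ _ (f≤g zero) ⟩
      g zero + ∑ (f ∘ suc)   ≡⟨ +-comm _ _ ⟩
      ∑ (f ∘ suc) + g zero   ∎)

  _⊙_ : ∀ {d} → Vec ℝ d → Vec ℝ d → Fin d → ℝ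
  (x ⊙ y) i = Vec.lookup x i * Vec.lookup y i

  ·-comm : ∀ {d} (x y : Vec ℝ d) → x · y ≡ y · x
  ·-comm x y = sum-cong-≗ (λ i → *-comm (Vec.lookup x i) (Vec.lookup y i))

  ·-+ᵥʳ : ∀ {d} (w x y : Vec ℝ d) → w · (x +ᵥ y) ≡ w · x + w · y
  ·-+ᵥʳ w x y = trans
    (sum-cong-≗ λ i → trans (cong (Vec.lookup w i *_) (Vecₚ.lookup-zipWith _+_ i x y)) (distribˡ _ _ _))
    (∑-distrib-+ (w ⊙ x) (w ⊙ y))

  ·-•ʳ : ∀ {d} (w : Vec ℝ d) t x → w · (t • x) ≡ t * (w · x)
  ·-•ʳ w t x = trans
    (sum-cong-≗ λ i → trans (cong (Vec.lookup w i *_) (Vecₚ.lookup-map i (t *_) x))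
      (solve 3 (λ w t x → w :* (t :* x) := t :* (w :* x)) refl (Vec.lookup w i) t (Vec.lookup x i)))
    (sym (*-distribˡ-sum t (w ⊙ x)))

  ·-+ᵥˡ : ∀ {d} (x y w : Vec ℝ d) → (x +ᵥ y) · w ≡ x · w + y · w
  ·-+ᵥˡ x y w = trans (·-comm (x +ᵥ y) w) (trans (·-+ᵥʳ w x y) (cong₂ _+_ (·-comm w x) (·-comm w y)))

  ·-•ˡ : ∀ {d} t (x w : Vec ℝ d) → (t • x) · w ≡ t * (x · w)
  ·-•ˡ t x w = trans (·-comm (t • x) w) (trans (·-•ʳ w t x) (cong (t *_) (·-comm w x)))

  ·-0ᵥʳ : ∀ {d} (w : Vec ℝ d) → w · 0ᵥ ≡ 0#
  ·-0ᵥʳ {d} w = trans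
    (sum-cong-≗ λ i → trans (cong (Vec.lookup w i *_) (Vecₚ.lookup-replicate i 0#)) (zeroʳ _))
    (sum-replicate-zero d)

  ·--ᵥʳ : ∀ {d} (w x y : Vec ℝ d) → w · (x -ᵥ y) + w · y ≡ w · x
  ·--ᵥʳ w x y = trans (sym (·-+ᵥʳ w (x -ᵥ y) y)) (sum-cong-≗ λ i → cong (Vec.lookup w i *_)
    (trans (Vecₚ.lookup-zipWith _+_ i (x -ᵥ y) y)
      (trans (cong (_+ Vec.lookup y i) (Vecₚ.lookup-zipWith _ i x y)) ([x-y]+y≡x _ _))))

  ·-∑ᵥʳ : ∀ {d n} (w : Vec ℝ d) (p : Fin n → Vec ℝ d) → w · ∑ᵥ p ≡ ∑ (λ i → w · p i)
  ·-∑ᵥʳ {n = ℕ.zero}  w p = ·-0ᵥʳ w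
  ·-∑ᵥʳ {n = ℕ.suc n} w p = trans (·-+ᵥʳ w (p zero) (∑ᵥ (p ∘ suc))) (cong (w · p zero +_) (·-∑ᵥʳ w (p ∘ suc)))

  x·x-nonneg : ∀ {d} (x : Vec ℝ d) → 0# ≤ x · x
  x·x-nonneg {d} x = subst (_≤ x · x) (sum-replicate-zero d) (∑-mono-≤ λ i → x*x-nonneg (Vec.lookup x i))

  2x·y≤x²+y² : ∀ {d} (x y : Vec ℝ d) → x · y + x · y ≤ x · x + y · y
  2x·y≤x²+y² x y = subst₂ _≤_ (∑-distrib-+ (x ⊙ y) (x ⊙ y)) (∑-distrib-+ (x ⊙ x) (y ⊙ y))
    (∑-mono-≤ λ i → 2xy≤x²+y² (Vec.lookup x i) (Vec.lookup y i))

  -- Equality case of `2x·y≤x²+y²`: the two sides differ by the squared distance, and `∑-tight`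
  -- reduces the claim to single coordinates.
  x²+y²≤2x·y⇒x≡y : ExcludedMiddle 0ℓ → ∀ {d} {x y : Vec ℝ d} → x · x + y · y ≤ x · y + x · y → x ≡ y
  x²+y²≤2x·y⇒x≡y em {x = x} {y} p = Pointwise-≡⇒≡ (ext λ i → 2xy≡x²+y²⇒x≡y em
    (∑-tight (λ i → 2xy≤x²+y² (Vec.lookup x i) (Vec.lookup y i))
      (subst₂ _≤_ (sym (∑-distrib-+ (x ⊙ x) (y ⊙ y))) (sym (∑-distrib-+ (x ⊙ y) (x ⊙ y))) p) i))

  -- Convex hulls and their faces.

  ⊆-conv : ∀ {d} (S : Pred (Vec ℝ d) 0ℓ) → S ⊆ conv S
  ⊆-conv S {x} x∈S = 1 , (λ _ → 1#) , (λ _ → x) , (λ _ → proj₁ 0<1) , +-identityʳ 1# , (λ _ → x∈S) ,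
    sym (1•x+0≡x x)
    where
    1•x+0≡x : ∀ {d} (x : Vec ℝ d) → 1# • x +ᵥ 0ᵥ ≡ x
    1•x+0≡x Vec.[]      = refl
    1•x+0≡x (a Vec.∷ x) = cong₂ Vec._∷_ (trans (+-identityʳ _) (*-identityˡ a)) (1•x+0≡x x)

  conv-mono : ∀ {d} (S T : Pred (Vec ℝ d) 0ℓ) → S ⊆ T → conv S ⊆ conv T
  conv-mono S T S⊆T (m , t , p , 0≤t , ∑t≡1 , p∈S , x≡) = m , t , p , 0≤t , ∑t≡1 , (λ i → S⊆T (p∈S i)) , x≡

  ·-convexCombination : ∀ {d m} (w : Vec ℝ d) (t : Fin m → ℝ) (p : Fin m → Vec ℝ d) →
                        w · ∑ᵥ (λ i → t i • p i) ≡ ∑ (λ i → t i * (w · p i))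
  ·-convexCombination w t p = trans (·-∑ᵥʳ w (λ i → t i • p i)) (sum-cong-≗ λ i → ·-•ʳ w (t i) (p i))

  ∑t*b≡b : ∀ {m} (t : Fin m → ℝ) → ∑ t ≡ 1# → ∀ b → ∑ (λ i → t i * b) ≡ b
  ∑t*b≡b t ∑t≡1 b = trans (sym (*-distribʳ-sum b t)) (trans (cong (_* b) ∑t≡1) (*-identityˡ b))

  conv-≤ : ∀ {d} (S : Pred (Vec ℝ d) 0ℓ) (w : Vec ℝ d) {b} →
           (∀ s → s ∈ S → w · s ≤ b) → ∀ {x} → x ∈ conv S → w · x ≤ b
  conv-≤ S w {b} S≤b {x} (m , t , p , 0≤t , ∑t≡1 , p∈S , refl) = begin
    w · ∑ᵥ (λ i → t i • p i)   ≡⟨ ·-convexCombination w t p ⟩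
    ∑ (λ i → t i * (w · p i))  ≤⟨ ∑-mono-≤ (λ i → *-monoˡ-≤ (0≤t i) (S≤b (p i) (p∈S i))) ⟩
    ∑ (λ i → t i * b)          ≡⟨ ∑t*b≡b t ∑t≡1 b ⟩
    b                          ∎

  -- A convex combination reaches the maximum `w · s₀` only if every generator of nonzero weight
  -- does. It serves both for the edges of the given polytope and for the faces of the pivot rule
  -- polytope.
  face-conv : ExcludedMiddle 0ℓ → ∀ {d} (S : Pred (Vec ℝ d) 0ℓ) (w : Vec ℝ d) {s₀} →
              s₀ ∈ S → (∀ s → s ∈ S → w · s ≤ w · s₀) →
              face (conv S) w ≐ conv (λ s → s ∈ S × w · s₀ ≤ w · s)
  face-conv em S w {s₀} s₀∈S S≤s₀ = to , from
    where
    S₀ : Pred _ 0ℓ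
    S₀ s = s ∈ S × w · s₀ ≤ w · s

    from : conv S₀ ⊆ face (conv S) w
    from {x} x∈ = conv-mono S₀ S proj₁ x∈ , λ y y∈ → begin
      w · y    ≤⟨ conv-≤ S w S≤s₀ y∈ ⟩
      w · s₀   ≤⟨ s₀≤x x∈ ⟩
      w · x    ∎
      where
      s₀≤x : ∀ {x} → x ∈ conv S₀ → w · s₀ ≤ w · x
      s₀≤x (m , t , p , 0≤t , ∑t≡1 , p∈S₀ , refl) = begin
        w · s₀                     ≡⟨ ∑t*b≡b t ∑t≡1 (w · s₀) ⟨
        ∑ (λ i → t i * (w · s₀))   ≤⟨ ∑-mono-≤ (λ i → *-monoˡ-≤ (0≤t i) (proj₂ (p∈S₀ i))) ⟩
        ∑ (λ i → t i * (w · p i))  ≡⟨ ·-convexCombination w t p ⟨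
        w · ∑ᵥ (λ i → t i • p i)   ∎

    -- Generators of weight zero need not be maximal; they are replaced by s₀.
    to : face (conv S) w ⊆ conv S₀
    to ((m , t , p , 0≤t , ∑t≡1 , p∈S , refl) , maximal) =
      m , t , q , 0≤t , ∑t≡1 , q∈S₀ , ∑ᵥ-cong (λ i → sym (t•q≡t•p i))
      where
      tight : ∀ i → t i * (w · p i) ≡ t i * (w · s₀)
      -- Each term is at most its counterpart with `s₀`, while maximality of the combination bounds
      -- the totals the other way.
      tight = ∑-tight (λ i → *-monoˡ-≤ (0≤t i) (S≤s₀ (p i) (p∈S i))) (begin
        ∑ (λ i → t i * (w · s₀))   ≡⟨ ∑t*b≡b t ∑t≡1 (w · s₀) ⟩
        w · s₀                     ≤⟨ maximal s₀ (⊆-conv S s₀∈S) ⟩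
        w · ∑ᵥ (λ i → t i • p i)   ≡⟨ ·-convexCombination w t p ⟩
        ∑ (λ i → t i * (w · p i))  ∎)

      replaced : ∀ i → ∃[ s ] s ∈ S₀ × t i • s ≡ t i • p i
      replaced i with em {t i ≡ 0#}
      ... | yes tᵢ≡0 = s₀ , (s₀∈S , ≤-refl) , trans (cong (_• s₀) tᵢ≡0)
                         (trans (0•x≡0•y s₀ (p i)) (cong (_• p i) (sym tᵢ≡0)))
        where
        0•x≡0•y : ∀ {d} (x y : Vec ℝ d) → 0# • x ≡ 0# • y
        0•x≡0•y Vec.[]      Vec.[]      = refl
        0•x≡0•y (a Vec.∷ x) (b Vec.∷ y) = cong₂ Vec._∷_ (trans (zeroˡ a) (sym (zeroˡ b))) (0•x≡0•y x y)
      ... | no  tᵢ≢0 = p i , (p∈S i , ≤-reflexive (sym (*-cancelˡ-≡ tᵢ≢0 (tight i)))) , refl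

      q : Fin m → Vec ℝ _
      q = proj₁ ∘ replaced
      q∈S₀ : ∀ i → q i ∈ S₀
      q∈S₀ i = proj₁ (proj₂ (replaced i))
      t•q≡t•p : ∀ i → t i • q i ≡ t i • p i
      t•q≡t•p i = proj₂ (proj₂ (replaced i))

      ∑ᵥ-cong : ∀ {n} {f g : Fin n → Vec ℝ _} → (∀ i → f i ≡ g i) → ∑ᵥ f ≡ ∑ᵥ g
      ∑ᵥ-cong {ℕ.zero}  f≗g = refl
      ∑ᵥ-cong {ℕ.suc n} f≗g = cong₂ _+ᵥ_ (f≗g zero) (∑ᵥ-cong (f≗g ∘ suc))

-- Improving edges out of a vertex, by way of the vertex figure.

module ImprovingEdge (em : ExcludedMiddle 0ℓ) (R : RealNumbers) {d : ℕ} (P : Geometry.Polytope R d) where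

  open RealNumbers R
  open Geometry R
  open OrderedField R
  open LinearAlgebra R
  open Polytope P

  -- Strictness holds because a second vertex with the maximal value would lie in the one-point
  -- face, hence coincide with `v`.
  exposing-functional : ∀ v → ∃[ w ] (∀ x → x ≢ v → w · point x < w · point v)
  exposing-functional v with point-isVertex v
  ... | w , face⊆v , v⊆face = w , λ x x≢v → w·x≤w·v (point x) (⊆-conv points (x , refl)) ,
          λ w·x≡w·v → x≢v (sym (point-injective (face⊆v
            (⊆-conv points (x , refl) , λ y y∈ → subst (w · y ≤_) (sym w·x≡w·v) (w·x≤w·v y y∈)))))
    where
    w·x≤w·v : ∀ y → y ∈ body → w · y ≤ w · point v
    w·x≤w·v = proj₂ (v⊆face refl)

  -- By `face-conv` the face of `g` is the hull of the vertices maximizing `g`; the hypotheses leave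
  -- exactly `v` and `u`, so this hull is the segment.
  exposed⇒edge : ∀ {v u} (g : Vec ℝ d) → u ≢ v → g · point v ≤ g · point u →
                 (∀ x → g · point x ≤ g · point v) →
                 (∀ x → x ≢ v → g · point v ≤ g · point x → x ≡ u) → IsEdge v u
  exposed⇒edge {v} {u} g u≢v g·v≤g·u g·x≤g·v maximal⇒u = ≢-sym u≢v , g ,
    (λ x∈ → conv-mono maximal ends ⊆-ends (proj₁ face≐ x∈)) ,
    (λ x∈ → proj₂ face≐ (conv-mono ends maximal ends-⊆ x∈))
    where
    maximal ends : Pred (Vec ℝ d) 0ℓ
    maximal x = x ∈ points × g · point v ≤ g · x
    ends x = x ≡ point v ⊎ x ≡ point u

    face≐ : face body g ≐ conv maximal
    face≐ = face-conv em points g {point v} (v , refl) λ { _ (x , refl) → g·x≤g·v x }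

    ⊆-ends : maximal ⊆ ends
    ⊆-ends ((x , refl) , g·v≤g·x) with x ≟ v
    ... | yes x≡v = inj₁ (cong point x≡v)
    ... | no  x≢v = inj₂ (cong point (maximal⇒u x x≢v g·v≤g·x))

    ends-⊆ : ends ⊆ maximal
    ends-⊆ (inj₁ refl) = (v , refl) , ≤-refl
    ends-⊆ (inj₂ refl) = (u , refl) , g·v≤g·u

  module VertexFigure (v : V) (w : Vec ℝ d)
    (w·x<w·v : ∀ x → x ≢ v → w · point x < w · point v) where

    -- At `x = v` the gap is `0#` and `scale` takes an unconstrained value, hence the assumption
    -- `x ≢ v` in the facts about signs below.
    gap scale : V → ℝ
    gap x = w · point v + - (w · point x)
    scale x = gap x ⁻¹

    -- The ray from v through x meets the hyperplane w · (y - v) = -1 in v + dir x.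
    ray dir : V → Vec ℝ d
    ray x = point x -ᵥ point v
    dir x = scale x • ray x

    0<gap : ∀ {x} → x ≢ v → 0# < gap x
    0<gap x≢v = x<y⇒0<y-x (w·x<w·v _ x≢v)

    0<scale : ∀ {x} → x ≢ v → 0# < scale x
    0<scale x≢v = ⁻¹-pos (0<gap x≢v)

    ·-ray : ∀ f x → f · ray x + f · point v ≡ f · point x
    ·-ray f x = ·--ᵥʳ f (point x) (point v)

    ·-dir : ∀ f x → f · dir x ≡ scale x * (f · ray x)
    ·-dir f x = ·-•ʳ f (scale x) (ray x)

    -- Consequently adding a multiple of `w` to a functional shifts it by a constant on the whole
    -- vertex figure.
    w·dir+1≡0 : ∀ {x} → x ≢ v → w · dir x + 1# ≡ 0#
    w·dir+1≡0 {x} x≢v = begin-equality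
      w · dir x + 1#                          ≡⟨ cong₂ _+_ (·-dir w x) (sym gap*scale≡1) ⟩
      scale x * (w · ray x) + gap x * scale x ≡⟨ xy+zx≡x[y+z] (scale x) (w · ray x) (gap x) ⟩
      scale x * (w · ray x + gap x)           ≡⟨ cong (scale x *_) (+-assoc _ _ _) ⟨
      scale x * (w · ray x + w · point v + - (w · point x))
                                              ≡⟨ cong (λ t → scale x * (t + - (w · point x))) (·-ray w x) ⟩
      scale x * (w · point x + - (w · point x))
                                              ≡⟨ cong (scale x *_) (-‿inverseʳ (w · point x)) ⟩
      scale x * 0#                            ≡⟨ zeroʳ (scale x) ⟩
      0#                                      ∎
      where
      gap*scale≡1 : gap x * scale x ≡ 1#
      gap*scale≡1 = *-inverseʳ (gap x) (≢-sym (proj₂ (0<gap x≢v)))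

    ·-≤⇒0≤·-ray : ∀ f x → f · point v ≤ f · point x → 0# ≤ f · ray x
    ·-≤⇒0≤·-ray f x f·v≤f·x = +-cancelʳ-≤ (f · point v)
      (subst₂ _≤_ (sym (+-identityˡ _)) (sym (·-ray f x)) f·v≤f·x)

    -- Since `dir x` is a positive multiple of `ray x`, the sign of `f · dir x` tells how `f`
    -- compares at `x` and `v`. This lemma and the next two translate between the polytope and its
    -- vertex figure.
    ·-≤⇒0≤·-dir : ∀ f {x} → x ≢ v → f · point v ≤ f · point x → 0# ≤ f · dir x
    ·-≤⇒0≤·-dir f {x} x≢v f·v≤f·x = subst (0# ≤_) (sym (·-dir f x))
      (*-nonneg (proj₁ (0<scale x≢v)) (·-≤⇒0≤·-ray f x f·v≤f·x))

    0≤·-dir⇒·-≤ : ∀ f {x} → x ≢ v → 0# ≤ f · dir x → f · point v ≤ f · point x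
    0≤·-dir⇒·-≤ f {x} x≢v 0≤f·dir = subst (f · point v ≤_) (·-ray f x) (0≤y⇒x≤y+x _
      (*-cancelˡ-≤ (0<scale x≢v) (subst₂ _≤_ (sym (zeroʳ _)) (·-dir f x) 0≤f·dir)))

    ·-dir≤0⇒·-≤ : ∀ f {x} → x ≢ v → f · dir x ≤ 0# → f · point x ≤ f · point v
    ·-dir≤0⇒·-≤ f {x} x≢v f·dir≤0 = subst₂ _≤_ (·-ray f x) (+-identityˡ _) (+-monoˡ-≤ (f · point v)
      (*-cancelˡ-≤ (0<scale x≢v) (subst₂ _≤_ (·-dir f x) (sym (zeroʳ _)) f·dir≤0)))

    -- Were two vertices on the same ray from v, the nearer one would lie strictly between v
    -- and the other, so no functional could expose it.
    dir-distinct : ∀ {x u} → x ≢ v → u ≢ v → x ≢ u → scale x ≤ scale u → dir x ≢ dir u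
    -- The larger `scale` has the smaller gap, so `u` is the nearer vertex and the one to expose.
    dir-distinct {x} {u} x≢v u≢v x≢u sₓ≤sᵤ dirx≡diru with exposing-functional u
    ... | f , exposes = ≤⇒≯ f·u≤f·x (exposes x x≢u)
      where
      f·ray-u≤f·ray-x : f · ray u ≤ f · ray x
      f·ray-u≤f·ray-x = *-cancelˡ-≤ (0<scale x≢v) (begin
        scale x * (f · ray u)   ≤⟨ *-monoʳ-≤ (·-≤⇒0≤·-ray f u (proj₁ (exposes v (≢-sym u≢v)))) sₓ≤sᵤ ⟩
        scale u * (f · ray u)   ≡⟨ ·-dir f u ⟨
        f · dir u               ≡⟨ cong (f ·_) dirx≡diru ⟨
        f · dir x               ≡⟨ ·-dir f x ⟩
        scale x * (f · ray x)   ∎)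
      f·u≤f·x : f · point u ≤ f · point x
      f·u≤f·x = subst₂ _≤_ (·-ray f u) (·-ray f x) (+-monoˡ-≤ (f · point v) f·ray-u≤f·ray-x)

    dir-injective : ∀ {x u} → x ≢ v → u ≢ v → dir x ≡ dir u → x ≡ u
    dir-injective {x} {u} x≢v u≢v dirx≡diru with x ≟ u
    ... | yes x≡u = x≡u
    ... | no  x≢u with total (scale x) (scale u)
    ...   | inj₁ sₓ≤sᵤ = contradiction dirx≡diru (dir-distinct x≢v u≢v x≢u sₓ≤sᵤ)
    ...   | inj₂ sᵤ≤sₓ = contradiction (sym dirx≡diru) (dir-distinct u≢v x≢v (≢-sym x≢u) sᵤ≤sₓ)

    height : Vec ℝ d → ℝ → V → ℝ
    height c N x = dir x · dir x + N * (c · dir x)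

    -- A maximizer u of |dir x|² + N (c · dir x) is a vertex of the vertex figure, exposed by
    -- N c + 2 dir u.
    module Highest (c : Vec ℝ d) (N : ℝ) (u : V) (u≢v : u ≢ v)
      (highest : ∀ {x} → x ≢ v → height c N x ≤ height c N u) where

      -- `f` is the gradient at `dir u` of the convex function |y|² + N (c · y), so a maximizer of
      -- the latter also maximizes `f` on the vertex figure. As `w` is -1 there, the multiple of `w`
      -- in `g` subtracts this maximum: `g` vanishes at `dir u` and is nonpositive on the other
      -- directions.
      f g : Vec ℝ d
      f = N • c +ᵥ (dir u +ᵥ dir u)
      g = f +ᵥ (f · dir u) • w

      f·dir : ∀ x → f · dir x ≡ N * (c · dir x) + (dir u · dir x + dir u · dir x)
      f·dir x = trans (·-+ᵥˡ (N • c) (dir u +ᵥ dir u) (dir x))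
        (cong₂ _+_ (·-•ˡ N c (dir x)) (·-+ᵥˡ (dir u) (dir u) (dir x)))

      g·dir+f·dir-u : ∀ {x} → x ≢ v → g · dir x + f · dir u ≡ f · dir x
      g·dir+f·dir-u {x} x≢v = begin-equality
        g · dir x + β                       ≡⟨ cong (_+ β) (·-+ᵥˡ f (β • w) (dir x)) ⟩
        f · dir x + (β • w) · dir x + β     ≡⟨ cong (λ t → f · dir x + t + β) (·-•ˡ β w (dir x)) ⟩
        f · dir x + β * (w · dir x) + β     ≡⟨ +-assoc _ _ β ⟩
        f · dir x + (β * (w · dir x) + β)   ≡⟨ cong (λ t → f · dir x + (β * (w · dir x) + t)) (*-identityʳ β) ⟨
        f · dir x + (β * (w · dir x) + β * 1#)
                                            ≡⟨ cong (f · dir x +_) (distribˡ β _ _) ⟨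
        f · dir x + β * (w · dir x + 1#)    ≡⟨ cong (λ t → f · dir x + β * t) (w·dir+1≡0 x≢v) ⟩
        f · dir x + β * 0#                  ≡⟨ cong (f · dir x +_) (zeroʳ β) ⟩
        f · dir x + 0#                      ≡⟨ +-identityʳ _ ⟩
        f · dir x                           ∎
        where β = f · dir u

      -- This is `highest` with `dir u · dir u` added on both sides. Kept separate because it yields
      -- both the maximality of `dir u` and, in the equality case, its uniqueness.
      N*c+squares≤f·dir-u : ∀ {x} → x ≢ v →
        N * (c · dir x) + (dir u · dir u + dir x · dir x) ≤ f · dir u
      N*c+squares≤f·dir-u {x} x≢v = begin
        N * (c · dir x) + (dir u · dir u + dir x · dir x)   ≡⟨ x+[y+z]≡z+x+y (N * (c · dir x)) _ _ ⟩
        height c N x + dir u · dir u                        ≤⟨ +-monoˡ-≤ _ (highest x≢v) ⟩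
        height c N u + dir u · dir u                        ≡⟨ x+[y+z]≡z+x+y (N * (c · dir u)) _ _ ⟨
        N * (c · dir u) + (dir u · dir u + dir u · dir u)   ≡⟨ f·dir u ⟨
        f · dir u                                           ∎

      f·dir≤f·dir-u : ∀ {x} → x ≢ v → f · dir x ≤ f · dir u
      f·dir≤f·dir-u {x} x≢v = begin
        f · dir x                                           ≡⟨ f·dir x ⟩
        N * (c · dir x) + (dir u · dir x + dir u · dir x)   ≤⟨ +-monoʳ-≤ _ (2x·y≤x²+y² (dir u) (dir x)) ⟩
        N * (c · dir x) + (dir u · dir u + dir x · dir x)   ≤⟨ N*c+squares≤f·dir-u x≢v ⟩
        f · dir u                                           ∎

      g·dir≤0 : ∀ {x} → x ≢ v → g · dir x ≤ 0#
      g·dir≤0 x≢v = +-cancelʳ-≤ (f · dir u)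
        (subst₂ _≤_ (sym (g·dir+f·dir-u x≢v)) (sym (+-identityˡ _)) (f·dir≤f·dir-u x≢v))

      g·dir-u≡0 : g · dir u ≡ 0#
      g·dir-u≡0 = +-cancelʳ (f · dir u) _ _ (trans (g·dir+f·dir-u u≢v) (sym (+-identityˡ _)))

      -- If `x` is maximal too, the bound through the squares is attained, so |dir u|² + |dir x|² is
      -- at most twice `dir u · dir x`.
      maximal⇒dir-u : ∀ {x} → x ≢ v → 0# ≤ g · dir x → dir u ≡ dir x
      maximal⇒dir-u {x} x≢v 0≤g·dir = x²+y²≤2x·y⇒x≡y em
        (+-cancelʳ-≤ (N * (c · dir x)) (subst₂ _≤_ (+-comm _ _) (+-comm _ _) (begin
          N * (c · dir x) + (dir u · dir u + dir x · dir x)   ≤⟨ N*c+squares≤f·dir-u x≢v ⟩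
          f · dir u                                           ≤⟨ 0≤y⇒x≤y+x _ 0≤g·dir ⟩
          g · dir x + f · dir u                               ≡⟨ g·dir+f·dir-u x≢v ⟩
          f · dir x                                           ≡⟨ f·dir x ⟩
          N * (c · dir x) + (dir u · dir x + dir u · dir x)   ∎)))

      g·x≤g·v : ∀ x → g · point x ≤ g · point v
      g·x≤g·v x with x ≟ v
      ... | yes x≡v = ≤-reflexive (cong (λ y → g · point y) x≡v)
      ... | no  x≢v = ·-dir≤0⇒·-≤ g x≢v (g·dir≤0 x≢v)

      edge : IsEdge v u
      edge = exposed⇒edge g u≢v (0≤·-dir⇒·-≤ g u≢v (≤-reflexive (sym g·dir-u≡0))) g·x≤g·v
        λ x x≢v g·v≤g·x → dir-injective x≢v u≢v (sym (maximal⇒dir-u x≢v (·-≤⇒0≤·-dir g x≢v g·v≤g·x)))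

    module Improving (c : Vec ℝ d) (N : ℝ) (0≤N : 0# ≤ N)
      (dominating : ∀ x → 0# < - (c · dir x) → dir x · dir x < N * - (c · dir x)) where

      0≤height : ∀ {x} → x ≢ v → c · point v ≤ c · point x → 0# ≤ height c N x
      0≤height {x} x≢v c·v≤c·x = begin
        0#                 ≡⟨ +-identityˡ 0# ⟨
        0# + 0#            ≤⟨ +-mono-≤ (x·x-nonneg (dir x)) (*-nonneg 0≤N (·-≤⇒0≤·-dir c x≢v c·v≤c·x)) ⟩
        height c N x       ∎

      N*-c·dir≤dir² : ∀ {u} → 0# ≤ height c N u → N * - (c · dir u) ≤ dir u · dir u
      N*-c·dir≤dir² {u} 0≤height-u = +-cancelʳ-≤ (N * (c · dir u)) (begin
        N * - (c · dir u) + N * (c · dir u)   ≡⟨ distribˡ N _ _ ⟨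
        N * (- (c · dir u) + c · dir u)       ≡⟨ cong (N *_) (-‿inverseˡ (c · dir u)) ⟩
        N * 0#                                ≡⟨ zeroʳ N ⟩
        0#                                    ≤⟨ 0≤height-u ⟩
        height c N u                          ∎)

      -- If `c · dir u` were negative, `dominating` would make the linear term outweigh the square,
      -- and the height would be negative.
      0≤height⇒0≤c·dir : ∀ {u} → 0# ≤ height c N u → 0# ≤ c · dir u
      0≤height⇒0≤c·dir {u} 0≤height-u with total 0# (c · dir u) | em {c · dir u ≡ 0#}
      ... | inj₁ 0≤c·dir | _      = 0≤c·dir
      ... | inj₂ _       | yes ≡0 = ≤-reflexive (sym ≡0)
      ... | inj₂ c·dir≤0 | no ≢0  = contradiction
        (dominating u (subst (0# <_) (+-identityˡ _) (x<y⇒0<y-x (c·dir≤0 , ≢0))))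
        (≤⇒≯ (N*-c·dir≤dir² 0≤height-u))

    -- The height of `x₀` is nonnegative, hence so is that of the highest vertex `u`, and for the
    -- chosen `N` this forces `c` not to decrease towards `u`.
    improving-edge : ∀ (c : Vec ℝ d) {x₀} → x₀ ≢ v → c · point v ≤ c · point x₀ →
                     ∃[ u ] IsEdge v u × c · point v ≤ c · point u
    improving-edge c {x₀} x₀≢v c·v≤c·x₀ =
      let N , 0≤N , dominating = dominating-multiple (λ x → dir x · dir x) (λ x → - (c · dir x))
          u , u≢v , highest    = maximizer em (_≢ v) (x₀ , x₀≢v) (height c N)
          open Improving c N 0≤N dominating
      in u , Highest.edge c N u u≢v (highest _) , 0≤·-dir⇒·-≤ c u≢v
           (0≤height⇒0≤c·dir (≤-trans (0≤height x₀≢v c·v≤c·x₀) (highest x₀ x₀≢v)))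

open RealNumbers using (ℝ)

-- Coherent multi-arborescences and their selections.

module PivotRule (em : ExcludedMiddle 0ℓ) (R : RealNumbers) {d : ℕ} (P : Geometry.Polytope R d)
  (c : Vec (ℝ R) d) (generic : Geometry.IsGeneric R P c) (η : Vec (ℝ R) d → ℝ R) where

  open RealNumbers R hiding (ℝ)
  open Geometry R
    using ( _·_; _•_; _-ᵥ_; 0ᵥ; ∑; face; conv
          ; IsMultiArborescence; IsArborescence; CoherentMultiArborescence; NonemptyFace )
  open OrderedField R
  open LinearAlgebra R
  open Geometry.Polytope P
  open ImprovingEdge em R P

  opt : V
  opt = Geometry.v-opt R P c η

  Nb : V → Pred V 0ℓ
  Nb = Geometry.Nb R P c η

  slope : Vec (ℝ R) d → V → V → ℝ R
  slope = Geometry.slope R P c η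

  𝒜 : Vec (ℝ R) d → MultiMap V
  𝒜 = Geometry.arborescenceOf R P c η

  pivotPoint : (V → V) → Vec (ℝ R) d
  pivotPoint = Geometry.pivotPoint R P c η

  Π : Pred (Vec (ℝ R) d) 0ℓ
  Π = Geometry.Π R P c η

  c≤c·opt : ∀ v → c · point v ≤ c · point opt
  c≤c·opt v = lookup (Extrema.f[xs]≤f[argmax] totalOrder {f = λ v → c · point v} zero (allFin _)) (∈-allFin v)

  Nb-nonempty : ∀ {v} → v ≢ opt → Satisfiable (Nb v)
  Nb-nonempty {v} v≢opt =
    let w , w·x<w·v       = exposing-functional v
        -- The vertex `opt` witnesses that `c` is at least as large somewhere else; genericity then
        -- makes the inequality along the edge strict.
        u , v—u , c·v≤c·u = VertexFigure.improving-edge v w w·x<w·v c (≢-sym v≢opt) (c≤c·opt v)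
    in u , v—u , c·v≤c·u , generic v u v—u

  Selects : MultiMap V → (V → V) → Set
  Selects A a = ∀ v → a v ∈ A v

  𝒜-nonempty : ∀ w v → Satisfiable (𝒜 w v)
  𝒜-nonempty w v = by-cases (v ≟ opt)
    where
    by-cases : Dec (v ≡ opt) → Satisfiable (𝒜 w v)
    by-cases (yes v≡opt) = opt , inj₁ (v≡opt , refl)
    by-cases (no  v≢opt) =
      let u , u∈Nb , maximal = maximizer em (Nb v) (Nb-nonempty v≢opt) (slope w v)
      in u , inj₂ (v≢opt , u∈Nb , maximal)

  𝒜⊆Nb : ∀ w {v} → v ≢ opt → 𝒜 w v ⊆ Nb v
  𝒜⊆Nb w v≢opt (inj₁ (v≡opt , _))    = contradiction v≡opt v≢opt
  𝒜⊆Nb w v≢opt (inj₂ (_ , u∈Nb , _)) = u∈Nb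

  𝒜-opt : ∀ w {u} → u ∈ 𝒜 w opt → u ≡ opt
  𝒜-opt w (inj₁ (_ , u≡opt))   = u≡opt
  𝒜-opt w (inj₂ (opt≢opt , _)) = contradiction refl opt≢opt

  𝒜-isMultiArborescence : ∀ w → IsMultiArborescence P c η (𝒜 w)
  𝒜-isMultiArborescence w =
    𝒜-nonempty w , ((λ u∈ → sym (𝒜-opt w u∈)) , λ { refl → inj₁ (refl , refl) }) , λ v → 𝒜⊆Nb w

  selects⇒isArborescence : ∀ w {a} → Selects (𝒜 w) a → IsArborescence P c η a
  selects⇒isArborescence w {a} a∈ = (λ v → a v , refl) ,
    ((λ { refl → sym (𝒜-opt w (a∈ opt)) }) , λ { refl → 𝒜-opt w (a∈ opt) }) ,
    λ { v v≢opt refl → 𝒜⊆Nb w v≢opt (a∈ v) }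

  selection : ∀ w → ∃ (Selects (𝒜 w))
  selection w = proj₁ ∘ 𝒜-nonempty w , proj₂ ∘ 𝒜-nonempty w

  -- Choices at different vertices are independent, so any selection may be overridden at `v` alone.
  selection-through : ∀ w {v u} → u ∈ 𝒜 w v → ∃[ a ] Selects (𝒜 w) a × a v ≡ u
  selection-through w {v} {u} u∈ = proj₁ ∘ choice , proj₂ ∘ choice , choice-v
    where
    by-cases : ∀ {x} → Dec (x ≡ v) → Satisfiable (𝒜 w x)
    by-cases     (yes refl) = u , u∈
    by-cases {x} (no  _)    = 𝒜-nonempty w x
    choice : ∀ x → Satisfiable (𝒜 w x)
    choice x = by-cases (x ≟ v)
    choice-v : proj₁ (choice v) ≡ u
    -- Rewriting `v ≟ v` to `yes refl` makes the choice compute to `u`.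
    choice-v = cong (proj₁ ∘ by-cases) (≡-≟-identity _≟_ refl)

  -- The contribution of `v` to `w · pivotPoint a`, with the same conditional as in `pivotPoint` so
  -- that the sums match term by term.
  score : Vec (ℝ R) d → (V → V) → V → ℝ R
  score w a v = if does (v ≟ opt) then 0# else slope w v (a v)

  step : (V → V) → V → Vec (ℝ R) d
  step a v = if does (v ≟ opt) then 0ᵥ else (η (point (a v) -ᵥ point v)) ⁻¹ • (point (a v) -ᵥ point v)

  ·-pivotPoint : ∀ w a → w · pivotPoint a ≡ ∑ (score w a)
  ·-pivotPoint w a = trans (·-∑ᵥʳ w (step a)) (sum-cong-≗ ·-step)
    where
    open Sum semiring using (sum-cong-≗)
    ·-step : ∀ v → w · step a v ≡ score w a v
    ·-step v = by-cases (does (v ≟ opt))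
      where
      ray = point (a v) -ᵥ point v
      by-cases : ∀ b → w · (if b then 0ᵥ else η ray ⁻¹ • ray) ≡ (if b then 0# else slope w v (a v))
      by-cases true  = ·-0ᵥʳ w
      by-cases false = trans (·-•ʳ w (η ray ⁻¹) ray) (*-comm (η ray ⁻¹) (w · ray))

  -- A selection maximizes the slope at each vertex separately, and `opt` contributes zero on both
  -- sides.
  score-≤ : ∀ w {a b} → IsArborescence P c η a → Selects (𝒜 w) b → ∀ v → score w a v ≤ score w b v
  score-≤ w {a} {b} (_ , _ , a∈Nb) b∈ v = by-cases (v ≟ opt) (b∈ v)
    where
    -- Abstracting the decision lets both conditionals reduce together.
    by-cases : (v≟opt : Dec (v ≡ opt)) → b v ∈ 𝒜 w v →
               (if does v≟opt then 0# else slope w v (a v)) ≤ (if does v≟opt then 0# else slope w v (b v))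
    by-cases (yes _)     _                      = ≤-refl
    by-cases (no  v≢opt) (inj₁ (v≡opt , _))     = contradiction v≡opt v≢opt
    by-cases (no  v≢opt) (inj₂ (_ , _ , maximal)) = maximal (a v) (a∈Nb v v≢opt refl)

  pivotPoint-≤ : ∀ w {a b} → IsArborescence P c η a → Selects (𝒜 w) b → w · pivotPoint a ≤ w · pivotPoint b
  pivotPoint-≤ w {a} {b} a-arb b∈ =
    subst₂ _≤_ (sym (·-pivotPoint w a)) (sym (·-pivotPoint w b)) (∑-mono-≤ (score-≤ w a-arb b∈))

  -- The scores of `a` are termwise at most those of `b`, so comparable totals force equality at
  -- every vertex; each `a v` thus attains the same maximal slope as `b v`.
  maximal⇒selects : ∀ w {a b} → IsArborescence P c η a → Selects (𝒜 w) b →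
                    w · pivotPoint b ≤ w · pivotPoint a → Selects (𝒜 w) a
  maximal⇒selects w {a} {b} a-arb@(_ , (opt∈ , _) , a∈Nb) b∈ b≤a v =
    by-cases (v ≟ opt) (b∈ v)
      (∑-tight (score-≤ w a-arb b∈) (subst₂ _≤_ (·-pivotPoint w b) (·-pivotPoint w a) b≤a) v)
    where
    by-cases : (v≟opt : Dec (v ≡ opt)) → b v ∈ 𝒜 w v →
               (if does v≟opt then 0# else slope w v (a v)) ≡ (if does v≟opt then 0# else slope w v (b v)) →
               a v ∈ 𝒜 w v
    by-cases (yes v≡opt) _                      _ =
      inj₁ (v≡opt , trans (cong a v≡opt) (sym (opt∈ refl)))
    by-cases (no  v≢opt) (inj₁ (v≡opt , _))     _ = contradiction v≡opt v≢opt
    by-cases (no  v≢opt) (inj₂ (_ , _ , maximal)) tight =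
      inj₂ (v≢opt , a∈Nb v v≢opt refl , λ u u∈Nb → subst (slope w v u ≤_) (sym tight) (maximal u u∈Nb))

  -- Faces of the pivot rule polytope.

  ArborescencePoint : Pred (Vec (ℝ R) d) 0ℓ
  ArborescencePoint x = ∃[ a ] IsArborescence P c η a × x ≡ pivotPoint a

  SelectionPoint : Vec (ℝ R) d → Pred (Vec (ℝ R) d) 0ℓ
  SelectionPoint w x = ∃[ a ] Selects (𝒜 w) a × x ≡ pivotPoint a

  -- After `face-conv`, with any selection as the maximal generator, it remains that the maximal
  -- arborescences are exactly the selections: `maximal⇒selects` and `pivotPoint-≤`.
  face-Π : ∀ w → face Π w ≐ conv (SelectionPoint w)
  face-Π w =
      (λ x∈ → conv-mono MaximalPoint (SelectionPoint w) ⊆-selection (proj₁ face≐ x∈))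
    , (λ x∈ → proj₂ face≐ (conv-mono (SelectionPoint w) MaximalPoint selection-⊆ x∈))
    where
    b = proj₁ (selection w)
    b∈ = proj₂ (selection w)

    MaximalPoint : Pred (Vec (ℝ R) d) 0ℓ
    MaximalPoint x = x ∈ ArborescencePoint × w · pivotPoint b ≤ w · x

    face≐ : face Π w ≐ conv MaximalPoint
    face≐ = face-conv em ArborescencePoint w (b , selects⇒isArborescence w b∈ , refl)
      λ { _ (a , a-arb , refl) → pivotPoint-≤ w a-arb b∈ }

    ⊆-selection : MaximalPoint ⊆ SelectionPoint w
    ⊆-selection ((a , a-arb , refl) , b≤a) = a , maximal⇒selects w a-arb b∈ b≤a , refl

    selection-⊆ : SelectionPoint w ⊆ MaximalPoint
    selection-⊆ (a , a∈ , refl) =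
      (a , selects⇒isArborescence w a∈ , refl) , pivotPoint-≤ w (selects⇒isArborescence w b∈) a∈

  face-mono : ∀ w w′ → 𝒜 w ⪯ 𝒜 w′ → face Π w ⊆ face Π w′
  face-mono w w′ A⪯A′ x∈ = proj₂ (face-Π w′) (conv-mono (SelectionPoint w) (SelectionPoint w′)
    (λ { (a , a∈ , x≡) → a , (λ v → A⪯A′ v (a∈ v)) , x≡ }) (proj₁ (face-Π w) x∈))

  -- A selection `a` of `𝒜 w` through `u` has its pivot point in the face of `w′`, where it does at
  -- least as well as a selection `b` of `𝒜 w′`; so `a` selects from `𝒜 w′` as well.
  face-cancel : ∀ w w′ → face Π w ⊆ face Π w′ → 𝒜 w ⪯ 𝒜 w′
  face-cancel w w′ F⊆F′ v {u} u∈ = subst (_∈ 𝒜 w′ v) av≡u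
    (maximal⇒selects w′ (selects⇒isArborescence w a∈) b∈
      (proj₂ a∈face (pivotPoint b) (⊆-conv ArborescencePoint (b , selects⇒isArborescence w′ b∈ , refl))) v)
    where
    a = proj₁ (selection-through w u∈)
    a∈ = proj₁ (proj₂ (selection-through w u∈))
    av≡u = proj₂ (proj₂ (selection-through w u∈))
    b = proj₁ (selection w′)
    b∈ = proj₂ (selection w′)
    a∈face : pivotPoint a ∈ face Π w′
    a∈face = F⊆F′ (proj₂ (face-Π w) (⊆-conv (SelectionPoint w) (a , a∈ , refl)))

  face-nonempty : ∀ w → Satisfiable (face Π w)
  face-nonempty w = pivotPoint (proj₁ (selection w)) ,
    proj₂ (face-Π w) (⊆-conv (SelectionPoint w) (_ , proj₂ (selection w) , refl))

  -- The order isomorphism between coherent multi-arborescences and nonempty faces.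

  Coherent Face : Set₁
  Coherent = CoherentMultiArborescence P c η
  Face = NonemptyFace P c η

  multiMap : Coherent → MultiMap V
  multiMap = CoherentMultiArborescence.multiMap

  weight : Coherent → Vec (ℝ R) d
  weight A = proj₁ (CoherentMultiArborescence.isCoherent A)

  multiMap≗𝒜 : ∀ A → multiMap A ≗ₘ 𝒜 (weight A)
  multiMap≗𝒜 A = proj₂ (CoherentMultiArborescence.isCoherent A)

  set : Face → Pred (Vec (ℝ R) d) 0ℓ
  set = NonemptyFace.set

  normal : Face → Vec (ℝ R) d
  normal F = proj₁ (NonemptyFace.isFace F)

  set≐face : ∀ F → set F ≐ face Π (normal F)
  set≐face F = proj₂ (NonemptyFace.isFace F)

  -- The face is built from the stored weight, which the multi-arborescence does not determine;
  -- `toFace-mono` shows that another weight for the same one gives the same face.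
  toFace : Coherent → Face
  toFace A = record
    { set      = face Π (weight A)
    ; nonempty = face-nonempty (weight A)
    ; isFace   = weight A , ≐-refl
    }

  fromFace : Face → Coherent
  fromFace F = record
    { multiMap            = 𝒜 (normal F)
    ; isMultiArborescence = 𝒜-isMultiArborescence (normal F)
    ; isCoherent          = normal F , λ v → ≐-refl
    }

  toFace-mono : ∀ A B → multiMap A ⪯ multiMap B → set (toFace A) ⊆ set (toFace B)
  toFace-mono A B A⪯B = face-mono (weight A) (weight B) λ v u∈ →
    proj₁ (multiMap≗𝒜 B v) (A⪯B v (proj₂ (multiMap≗𝒜 A v) u∈))

  toFace-cancel : ∀ A B → set (toFace A) ⊆ set (toFace B) → multiMap A ⪯ multiMap B
  toFace-cancel A B F⊆G v u∈ = proj₂ (multiMap≗𝒜 B v)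
    (face-cancel (weight A) (weight B) F⊆G v (proj₁ (multiMap≗𝒜 A v) u∈))

  -- Stated for every `A` equivalent to `fromFace F`, the form of surjectivity suited to posets
  -- whose equality is an equivalence relation.
  toFace-surjective : ∀ F A → multiMap A ≗ₘ multiMap (fromFace F) → set (toFace A) ≐ set F
  toFace-surjective F A A≗𝒜 =
      (λ x∈ → proj₂ (set≐face F) (toFace-mono A (fromFace F) (λ v → proj₁ (A≗𝒜 v)) x∈))
    , (λ x∈ → toFace-mono (fromFace F) A (λ v → proj₂ (A≗𝒜 v)) (proj₁ (set≐face F) x∈))

  coherent≅faces : Geometry.coherentPoset R P c η ≅ Geometry.facePoset R P c η
  coherent≅faces = toFace , record
    { isOrderMonomorphism = record
      { isOrderHomomorphism = record
        { cong = λ {A} {B} A≗B →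
            toFace-mono A B (λ v → proj₁ (A≗B v)) , toFace-mono B A (λ v → proj₂ (A≗B v))
        ; mono = λ {A} {B} → toFace-mono A B
        }
      ; injective = λ {A} {B} F≐G v → toFace-cancel A B (proj₁ F≐G) v , toFace-cancel B A (proj₂ F≐G) v
      ; cancel    = λ {A} {B} → toFace-cancel A B
      }
    ; surjective = λ F → fromFace F , λ {A} → toFace-surjective F A
    }

open Geometry

theorem5p4 : ExcludedMiddle 0ℓ →
    (R : RealNumbers) (d : ℕ)
    (P : Polytope R d) → IsSimple R P →
    (c : Vec (ℝ R) d) → IsGeneric R P c →
    (η : Vec (ℝ R) d → ℝ R) → IsNormalization R P c η →
    (∀ (w w′ : Vec (ℝ R) d) →
    (arborescenceOf R P c η w ⪯ arborescenceOf R P c η w′) ⇔ (face R (Π R P c η) w ⊆ face R (Π R P c η) w′)) ×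
    (coherentPoset R P c η ≅ facePoset R P c η)
theorem5p4 em R d P _ c generic η _ =
  (λ w w′ → mk⇔ (face-mono w w′) (face-cancel w w′)) , coherent≅faces
  where open PivotRule em R P c generic η
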